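{- Let $a,b,J$ be positive integers with $J\ge 3$. Then: (1) if $a\ge b$, then $H(a+b,J) \leq H(a,J)+H(b,J-1)+b$; in particular, if $a\ge 2$, then $H(2a-1,J) \leq H(a,J)+H(a-1,J-1)+a-1$; (2) $H(2a,J) \leq 2H(a,J-1)+2a$.
   Context: A Golomb ruler is a set $\{a_1,\dots,a_k\}$ of $k$ distinct non-negative integers such that all the differences $a_i-a_j$, $i\neq j$, are distinct. An $(I,J,n)$-DGR is a set of $I$ pairwise disjoint Golomb rulers, each being a $J$-element subset of $\{1,2,\dots,n\}$. For positive integers $I,J$, $H(I,J)$ is the least positive integer $n$ such that there is an $(I,J,n)$-DGR. -}

module Defs where

open import Data.Fin.Base using (Fin; zero; suc; combine; toℕ)
open import Data.Fin.Properties as Fin using (all?; toℕ<n; toℕ-injective; combine-injective)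
open import Data.Integer.Base as ℤ using (+_)
import Data.Integer.Properties as ℤ
open import Data.Nat.Base
open import Data.Nat.Properties
open import Data.Product.Base using (∃; _×_; _,_; proj₁; proj₂)
open import Data.Vec.Functional using (Vector; []; _∷_)
open import Data.Vec.Functional.Relation.Binary.Pointwise using (Pointwise)
open import Function.Base using (_∘_)
open import Function.Definitions using (Injective)
open import Relation.Binary.Core using (Rel)
open import Relation.Binary.Definitions
  using (Reflexive; _Respects_; tri<; tri≈; tri>)
open import Relation.Binary.PropositionalEquality
  using (_≡_; _≢_; refl; sym; trans; cong; cong₂; subst)
open import Relation.Nullary.Decidable
  using (Dec; yes; no; map′; ¬?; _×-dec_; _→-dec_)
open import Relation.Nullary.Negation using (contradiction)
open import Relation.Unary using (Pred; Decidable)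
open import Level using (0ℓ)

-- The set {a₁,…,aₖ} is given by an injective enumeration.  Differences
-- are signed and indexed by ordered pairs of distinct indices.
record IsGolombRuler {k : ℕ} (a : Vector ℕ k) : Set where
  field
    distinct             : Injective _≡_ _≡_ a
    differences-distinct : ∀ i j k l → i ≢ j → k ≢ l →
                           + a i ℤ.- + a j ≡ + a k ℤ.- + a l →
                           i ≡ k × j ≡ l

-- For J ≥ 1 pairwise disjoint rulers are different sets, so a set of I
-- of them is the same as a family indexed by Fin I.
record IsDGR (I J n : ℕ) (R : Vector (Vector ℕ J) I) : Set where
  field
    golomb   : ∀ r → IsGolombRuler (R r)
    range    : ∀ r i → 1 ≤ R r i × R r i ≤ n
    disjoint : ∀ r s → r ≢ s → ∀ i j → R r i ≢ R s j

HasDGR : (I J n : ℕ) → Set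
HasDGR I J n = ∃ λ R → IsDGR I J n R

IsLeast : Pred ℕ 0ℓ → Pred ℕ 0ℓ
IsLeast P n = P n × (∀ {m} → P m → n ≤ m)

private
  Search : (A : Set) → Rel A 0ℓ → Pred A 0ℓ → Set₁
  Search A _≈_ B = {P : Pred A 0ℓ} → P Respects _≈_ → Decidable P →
                   Dec (∃ λ x → B x × P x)

  searchBelow : ∀ v → Search ℕ _≡_ (_< v)
  searchBelow v _ P? = anyUpTo? P? v

  searchVector : ∀ {A : Set} {_≈_ : Rel A 0ℓ} {B : Pred A 0ℓ} →
                 Reflexive _≈_ → Search A _≈_ B →
                 ∀ n → Search (Vector A n) (Pointwise _≈_) (λ f → ∀ i → B (f i))
  searchVector ≈-refl search zero resp P? =
    map′ (λ p → [] , (λ ()) , p) (λ (f , _ , p) → resp (λ ()) p) (P? [])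
  searchVector {A} {_≈_} {B} ≈-refl search (suc n) {P} resp P? =
    map′ (λ (x , bx , g , bg , p) →
            x ∷ g , (λ { zero → bx ; (suc i) → bg i }) , p)
         (λ (f , bf , p) → f zero , bf zero , f ∘ suc , bf ∘ suc ,
            resp (λ { zero → ≈-refl ; (suc i) → ≈-refl }) p)
         (search
           (λ x≈y (g , bg , p) → g , bg ,
              resp (λ { zero → x≈y ; (suc i) → ≈-refl }) p)
           (λ x → searchVector ≈-refl search n
              (λ g≈h → resp (λ { zero → ≈-refl ; (suc i) → g≈h i }))
              (λ g → P? (x ∷ g))))

  isGolombRuler? : ∀ {k} → Decidable (IsGolombRuler {k})
  isGolombRuler? a = map′
    (λ (inj , diff) → record
      { distinct = λ {i} {j} → inj i j ; differences-distinct = diff })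
    (λ g → (λ i j → IsGolombRuler.distinct g) , IsGolombRuler.differences-distinct g)
    (all? (λ i → all? λ j → (a i ≟ a j) →-dec (i Fin.≟ j))
     ×-dec
     all? (λ i → all? λ j → all? λ k → all? λ l →
       ¬? (i Fin.≟ j) →-dec (¬? (k Fin.≟ l) →-dec
         ((+ a i ℤ.- + a j ℤ.≟ + a k ℤ.- + a l) →-dec
           ((i Fin.≟ k) ×-dec (j Fin.≟ l))))))

  isDGR? : ∀ I J n → Decidable (IsDGR I J n)
  isDGR? I J n R = map′
    (λ (g , r , d) → record { golomb = g ; range = r ; disjoint = d })
    (λ D → IsDGR.golomb D , IsDGR.range D , IsDGR.disjoint D)
    (all? (λ r → isGolombRuler? (R r))
     ×-dec
     (all? (λ r → all? λ i → (1 ≤? R r i) ×-dec (R r i ≤? n))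
      ×-dec
      all? (λ r → all? λ s → ¬? (r Fin.≟ s) →-dec
        all? λ i → all? λ j → ¬? (R r i ≟ R s j))))

  isGolombRuler-resp : ∀ {k} → IsGolombRuler {k} Respects Pointwise _≡_
  isGolombRuler-resp {x = a} {y = b} a≗b g = record
    { distinct = λ {i} {j} eq → distinct (trans (a≗b i) (trans eq (sym (a≗b j))))
    ; differences-distinct = λ i j k l i≢j k≢l eq →
        differences-distinct i j k l i≢j k≢l
          (trans (diff i j) (trans eq (sym (diff k l))))
    }
    where
    open IsGolombRuler g
    diff : ∀ i j → + a i ℤ.- + a j ≡ + b i ℤ.- + b j
    diff i j = cong₂ (λ x y → + x ℤ.- + y) (a≗b i) (a≗b j)

  isDGR-resp : ∀ {I J n} → IsDGR I J n Respects Pointwise (Pointwise _≡_)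
  isDGR-resp {n = n} R≗S D = record
    { golomb   = λ r → isGolombRuler-resp (R≗S r) (golomb r)
    ; range    = λ r i → subst (λ x → 1 ≤ x × x ≤ n) (R≗S r i) (range r i)
    ; disjoint = λ r s r≢s i j eq → disjoint r s r≢s i j
        (trans (R≗S r i) (trans eq (sym (R≗S s j))))
    }
    where open IsDGR D

hasDGR? : ∀ I J → Decidable (HasDGR I J)
hasDGR? I J n = map′
  (λ (R , _ , D) → R , D)
  (λ (R , D) → R , (λ r i → s≤s (proj₂ (IsDGR.range D r i))) , D)
  (searchVector (λ _ → refl)
    (λ {P} → searchVector refl (searchBelow (suc n)) J {P})
    I isDGR-resp (isDGR? I J n))

private
  2^-injective : ∀ {m n} → 2 ^ m ≡ 2 ^ n → m ≡ n
  2^-injective {m} {n} eq with <-cmp m n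
  ... | tri< m<n _ _ = contradiction eq (<⇒≢ (^-monoʳ-< 2 (s≤s (s≤s z≤n)) m<n))
  ... | tri≈ _ m≡n _ = m≡n
  ... | tri> _ _ n<m = contradiction (sym eq) (<⇒≢ (^-monoʳ-< 2 (s≤s (s≤s z≤n)) n<m))

  2^+2^≤2^ : ∀ {x y z} → x < z → y < z → 2 ^ x + 2 ^ y ≤ 2 ^ z
  2^+2^≤2^ {x} {y} {suc z} (s≤s x≤z) (s≤s y≤z) = begin
    2 ^ x + 2 ^ y        ≤⟨ +-mono-≤ (^-monoʳ-≤ 2 x≤z) (^-monoʳ-≤ 2 y≤z) ⟩
    2 ^ z + 2 ^ z        ≡⟨ cong (λ w → 2 ^ z + w) (+-identityʳ (2 ^ z)) ⟨
    2 ^ suc z            ∎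
    where open ≤-Reasoning

  2^+2^-≢ : ∀ {p q s t} → p < s → s ≢ t → 2 ^ p + 2 ^ t ≢ 2 ^ s + 2 ^ q
  2^+2^-≢ {p} {q} {s} {t} p<s s≢t eq with <-cmp t s | q <? t
  ... | tri< t<s _ _ | _ = <⇒≢ (≤-<-trans (2^+2^≤2^ p<s t<s)
                                 (m<m+n (2 ^ s) (m^n>0 2 q))) eq
  ... | tri≈ _ t≡s _ | _ = s≢t (sym t≡s)
  ... | tri> _ _ s<t | yes q<t = <⇒≢ (≤-<-trans (2^+2^≤2^ s<t q<t)
                                       (m<n+m (2 ^ t) (m^n>0 2 p))) (sym eq)
  ... | tri> _ _ s<t | no q≮t = <⇒≢ (+-mono-<-≤ (^-monoʳ-< 2 (s≤s (s≤s z≤n)) p<s)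
                                       (^-monoʳ-≤ 2 (≮⇒≥ q≮t))) eq

  -⇒+ : ∀ a b c d → + a ℤ.- + b ≡ + c ℤ.- + d → a + d ≡ c + b
  -⇒+ a b c d eq = ℤ.+-injective (begin
    + a ℤ.+ + d                         ≡⟨ move (+ a) (+ b) (+ d) ⟨
    (+ a ℤ.- + b) ℤ.+ (+ b ℤ.+ + d)     ≡⟨ cong₂ ℤ._+_ eq (ℤ.+-comm (+ b) (+ d)) ⟩
    (+ c ℤ.- + d) ℤ.+ (+ d ℤ.+ + b)     ≡⟨ move (+ c) (+ d) (+ b) ⟩
    + c ℤ.+ + b                         ∎)
    where
    open Relation.Binary.PropositionalEquality.≡-Reasoning
    move : ∀ x y z → (x ℤ.- y) ℤ.+ (y ℤ.+ z) ≡ x ℤ.+ z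
    move x y z = begin
      (x ℤ.- y) ℤ.+ (y ℤ.+ z)       ≡⟨ ℤ.+-assoc (x ℤ.- y) y z ⟨
      ((x ℤ.- y) ℤ.+ y) ℤ.+ z       ≡⟨ cong (ℤ._+ z) (ℤ.+-assoc x (ℤ.- y) y) ⟩
      (x ℤ.+ (ℤ.- y ℤ.+ y)) ℤ.+ z   ≡⟨ cong (λ w → (x ℤ.+ w) ℤ.+ z) (ℤ.+-inverseˡ y) ⟩
      (x ℤ.+ ℤ.0ℤ) ℤ.+ z            ≡⟨ cong (ℤ._+ z) (ℤ.+-identityʳ x) ⟩
      x ℤ.+ z                       ∎

  2^-diff : ∀ p q s t → p ≢ q → s ≢ t →
            + (2 ^ p) ℤ.- + (2 ^ q) ≡ + (2 ^ s) ℤ.- + (2 ^ t) →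
            p ≡ s × q ≡ t
  2^-diff p q s t p≢q s≢t eq
    with <-cmp p s | -⇒+ (2 ^ p) (2 ^ q) (2 ^ s) (2 ^ t) eq
  ... | tri< p<s _ _ | eq′ = contradiction eq′ (2^+2^-≢ {q = q} p<s s≢t)
  ... | tri≈ _ refl _ | eq′ =
          refl , sym (2^-injective (+-cancelˡ-≡ (2 ^ p) (2 ^ t) (2 ^ q) eq′))
  ... | tri> _ _ s<p | eq′ = contradiction (sym eq′) (2^+2^-≢ {q = t} s<p p≢q)

  -- Distinct powers of two have distinct differences, so an
  -- (I,J,n)-DGR exists for n = 2 ^ (I * J).
  powers : ∀ I J → Vector (Vector ℕ J) I
  powers I J r i = 2 ^ toℕ (combine r i)

  powers-isDGR : ∀ I J → IsDGR I J (2 ^ (I * J)) (powers I J)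
  powers-isDGR I J = record
    { golomb = λ r → record
        { distinct = λ {i} {j} eq → index-injective r i j (2^-injective eq)
        ; differences-distinct = λ i j k l i≢j k≢l eq →
            let p≡s , q≡t = 2^-diff _ _ _ _
                  (i≢j ∘ index-injective r i j) (k≢l ∘ index-injective r k l) eq
            in index-injective r i k p≡s , index-injective r j l q≡t
        }
    ; range = λ r i → m^n>0 2 (toℕ (combine r i)) ,
                      ^-monoʳ-≤ 2 (<⇒≤ (toℕ<n (combine r i)))
    ; disjoint = λ r s r≢s i j eq → r≢s
        (proj₁ (combine-injective r i s j (toℕ-injective (2^-injective eq))))
    }
    where
    index-injective : ∀ (r : Fin I) (i j : Fin J) →
                      toℕ (combine r i) ≡ toℕ (combine r j) → i ≡ j
    index-injective r i j eq = proj₂ (combine-injective r i r j (toℕ-injective eq))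

private
  least : ∀ {P : Pred ℕ 0ℓ} → Decidable P → ∀ n → P n → ∃ (IsLeast P)
  least P? zero p = zero , p , λ _ → z≤n
  least {P} P? (suc n) p with P? zero
  ... | yes p₀ = zero , p₀ , λ _ → z≤n
  ... | no ¬p₀ =
    let m , pm , min = least (P? ∘ suc) n p
    in suc m , pm , λ {k} → bound m min k
    where
    bound : ∀ m → (∀ {k} → P (suc k) → m ≤ k) → ∀ k → P k → suc m ≤ k
    bound m min zero    p₀ = contradiction p₀ ¬p₀
    bound m min (suc k) pk = s≤s (min pk)

  leastDGR : ∀ I J → ∃ (IsLeast (λ n → 1 ≤ n × HasDGR I J n))
  leastDGR I J = least (λ n → (1 ≤? n) ×-dec hasDGR? I J n)
    (2 ^ (I * J)) (m^n>0 2 (I * J) , powers I J , powers-isDGR I J)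

H : ℕ → ℕ → ℕ
H I J = proj₁ (leastDGR I J)

H-isLeast : ∀ I J → IsLeast (λ n → 1 ≤ n × HasDGR I J n) (H I J)
H-isLeast I J = proj₂ (leastDGR I J)

{-# OPTIONS --safe #-}

-- A ruler lying in an interval of length m stays a Golomb ruler when a point
-- at distance at least m from that interval is adjoined.  For (1), put b new
-- points, then the (a,J)-DGR, then the (b,J-1)-DGR, each ruler of the latter
-- being extended by one new point; the gap is H(a,J) ≥ H(b,J-1).  For (2), put
-- a new points, two copies of the (a,J-1)-DGR, then a new points, each copy
-- being extended by the new points beyond the other copy.
module Submission where

open import Defs
open import Data.Fin.Base using (Fin; zero; suc; toℕ; inject≤; splitAt; _↑ˡ_; _↑ʳ_)
open import Data.Fin.Properties using (toℕ<n; toℕ-injective; inject≤-injective; splitAt⁻¹-↑ˡ; splitAt⁻¹-↑ʳ)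
import Data.Integer.Base as ℤ
import Data.Integer.Properties as ℤ
import Data.Integer.Tactic.RingSolver as ℤ
open import Data.Nat.Base
  using (ℕ; suc; _+_; _*_; _∸_; _≤_; _≥_; _<_; z≤n; s≤s)
open import Data.Nat.Properties
open import Data.Nat.Tactic.RingSolver using (solve-∀)
open import Data.Product.Base using (_×_; _,_; proj₁; proj₂)
open import Data.Sum.Base using (inj₁; inj₂)
open import Data.Vec.Functional using (Vector; _∷_; _++_)
open import Function.Base using (_∘_)
open import Function.Definitions using (Injective)
open import Relation.Binary.PropositionalEquality
  using (_≡_; _≢_; refl; sym; trans; cong; cong₂; ≢-sym)
open import Relation.Nullary.Negation using (contradiction)

private
  variable
    I I′ J J′ K k m n N : ℕ

-- Golomb rulers: subsets, translates, adjoining a point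

-- Moves a coincidence of signed differences into `ℕ`, where it can be refuted by comparing sizes.
difference⇒sum : ∀ a b c d → ℤ.+ a ℤ.- ℤ.+ b ≡ ℤ.+ c ℤ.- ℤ.+ d → a + d ≡ c + b
difference⇒sum a b c d eq = ℤ.+-injective (begin
  ℤ.+ (a + d)                                     ≡⟨ ℤ.pos-+ a d ⟩
  ℤ.+ a ℤ.+ ℤ.+ d                                 ≡⟨ left (ℤ.+ a) (ℤ.+ b) (ℤ.+ d) ⟩
  (ℤ.+ a ℤ.- ℤ.+ b) ℤ.+ (ℤ.+ b ℤ.+ ℤ.+ d)         ≡⟨ cong (ℤ._+ (ℤ.+ b ℤ.+ ℤ.+ d)) eq ⟩
  (ℤ.+ c ℤ.- ℤ.+ d) ℤ.+ (ℤ.+ b ℤ.+ ℤ.+ d)         ≡⟨ right (ℤ.+ c) (ℤ.+ d) (ℤ.+ b) ⟩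
  ℤ.+ c ℤ.+ ℤ.+ b                                 ≡⟨ ℤ.pos-+ c b ⟨
  ℤ.+ (c + b)                                     ∎)
  where
  open Relation.Binary.PropositionalEquality.≡-Reasoning
  left : ∀ x y z → x ℤ.+ z ≡ (x ℤ.- y) ℤ.+ (y ℤ.+ z)
  left = ℤ.solve-∀
  right : ∀ x y z → (x ℤ.- y) ℤ.+ (z ℤ.+ y) ≡ x ℤ.+ z
  right = ℤ.solve-∀

difference-translate : ∀ c a b → ℤ.+ (c + a) ℤ.- ℤ.+ (c + b) ≡ ℤ.+ a ℤ.- ℤ.+ b
difference-translate c a b = trans (ℤ.m-n≡m⊖n (c + a) (c + b))
  (trans (ℤ.+-cancelˡ-⊖ c a b) (sym (ℤ.m-n≡m⊖n a b)))

isGolombRuler-reindex : ∀ {a : Vector ℕ k} {f : Fin n → Fin k} → Injective _≡_ _≡_ f →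
                        IsGolombRuler a → IsGolombRuler (a ∘ f)
isGolombRuler-reindex f-inj g = record
  { distinct = f-inj ∘ distinct
  ; differences-distinct = λ i j k l i≢j k≢l eq →
      let fi≡fk , fj≡fl = differences-distinct _ _ _ _ (i≢j ∘ f-inj) (k≢l ∘ f-inj) eq
      in f-inj fi≡fk , f-inj fj≡fl
  }
  where open IsGolombRuler g

isGolombRuler-translate : ∀ c {a : Vector ℕ k} → IsGolombRuler a → IsGolombRuler (λ i → c + a i)
isGolombRuler-translate c {a} g = record
  { distinct = distinct ∘ +-cancelˡ-≡ c _ _
  ; differences-distinct = λ i j k l i≢j k≢l eq → differences-distinct i j k l i≢j k≢l
      (trans (sym (difference-translate c (a i) (a j)))
        (trans eq (difference-translate c (a k) (a l))))
  }
  where open IsGolombRuler g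

-- The two ways in which a difference involving p could coincide with another
-- difference of p ∷ a, written additively.
record IsRemote (p : ℕ) (a : Vector ℕ k) : Set where
  field
    double≢ : ∀ i j → p + p ≢ a i + a j
    sum≢    : ∀ i j k → p + a i ≢ a j + a k

-- Since `i ≢ j` and `k ≢ l`, each difference involves `p` at most once. If `p` has the same
-- position in both, it cancels and `distinct` applies; in opposite positions the equation has
-- `p + p` on one side, against `double≢`; in only one difference, it contradicts `sum≢`. Otherwise
-- the ruler `a` itself decides.
isGolombRuler-∷ : ∀ {p} {a : Vector ℕ k} → IsRemote p a →
                  IsGolombRuler a → IsGolombRuler (p ∷ a)
isGolombRuler-∷ {p = p} {a} remote g = record
  { distinct = λ {i} {j} → inj i j
  ; differences-distinct = λ i j k l i≢j k≢l eq → diff i j k l i≢j k≢l eq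
      (difference⇒sum ((p ∷ a) i) ((p ∷ a) j) ((p ∷ a) k) ((p ∷ a) l) eq)
  }
  where
  open IsGolombRuler g
  open IsRemote remote

  inj : ∀ i j → (p ∷ a) i ≡ (p ∷ a) j → i ≡ j
  inj zero    zero    _  = refl
  -- Doubling `p ≡ a j` lets `double≢` also rule out that `p` is already a point of `a`.
  inj zero    (suc j) eq = contradiction (cong₂ _+_ eq eq) (double≢ j j)
  inj (suc i) zero    eq = contradiction (sym (cong₂ _+_ eq eq)) (double≢ i i)
  inj (suc i) (suc j) eq = cong suc (distinct eq)

  diff : ∀ i j k l → i ≢ j → k ≢ l →
         ℤ.+ (p ∷ a) i ℤ.- ℤ.+ (p ∷ a) j ≡ ℤ.+ (p ∷ a) k ℤ.- ℤ.+ (p ∷ a) l →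
         (p ∷ a) i + (p ∷ a) l ≡ (p ∷ a) k + (p ∷ a) j → i ≡ k × j ≡ l
  diff zero    zero    _       _       i≢j _ _ _ = contradiction refl i≢j
  diff _       _       zero    zero    _ k≢l _ _ = contradiction refl k≢l
  diff zero    (suc j) zero    (suc l) _ _ _ eq =
    refl , cong suc (sym (distinct (+-cancelˡ-≡ p _ _ eq)))
  diff (suc i) zero    (suc k) zero    _ _ _ eq =
    cong suc (distinct (+-cancelʳ-≡ p _ _ eq)) , refl
  diff zero    (suc j) (suc k) zero    _ _ _ eq = contradiction eq (double≢ k j)
  diff (suc i) zero    zero    (suc l) _ _ _ eq = contradiction (sym eq) (double≢ i l)
  diff zero    (suc j) (suc k) (suc l) _ _ _ eq = contradiction eq (sum≢ l k j)
  diff (suc i) zero    (suc k) (suc l) _ _ _ eq =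
    contradiction (trans (+-comm p (a k)) (sym eq)) (sum≢ k i l)
  diff (suc i) (suc j) zero    (suc l) _ _ _ eq = contradiction (sym eq) (sum≢ j i l)
  diff (suc i) (suc j) (suc k) zero    _ _ _ eq =
    contradiction (trans (+-comm p (a i)) eq) (sum≢ i k j)
  diff (suc i) (suc j) (suc k) (suc l) i≢j k≢l eq _ =
    let i≡k , j≡l = differences-distinct i j k l (i≢j ∘ cong suc) (k≢l ∘ cong suc) eq
    in cong suc i≡k , cong suc j≡l

-- Operations on families of disjoint rulers

isDGR-reindex : ∀ {R : Vector (Vector ℕ J) I} {f : Fin I′ → Fin I} {g : Fin J′ → Fin J} →
                Injective _≡_ _≡_ f → Injective _≡_ _≡_ g →
                IsDGR I J n R → IsDGR I′ J′ n (λ r i → R (f r) (g i))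
isDGR-reindex {f = f} {g} f-inj g-inj D = record
  { golomb   = λ r → isGolombRuler-reindex g-inj (golomb (f r))
  ; range    = λ r i → range (f r) (g i)
  ; disjoint = λ r s r≢s i j → disjoint (f r) (f s) (r≢s ∘ f-inj) (g i) (g j)
  }
  where open IsDGR D

isDGR-translate : ∀ c {R : Vector (Vector ℕ J) I} → c + n ≤ N →
                  IsDGR I J n R → IsDGR I J N (λ r i → c + R r i)
isDGR-translate c c+n≤N D = record
  { golomb   = λ r → isGolombRuler-translate c (golomb r)
  ; range    = λ r i → m≤n⇒m≤o+n c (proj₁ (range r i)) ,
                       ≤-trans (+-monoʳ-≤ c (proj₂ (range r i))) c+n≤N
  ; disjoint = λ r s r≢s i j → disjoint r s r≢s i j ∘ +-cancelˡ-≡ c _ _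
  }
  where open IsDGR D

isDGR-++ : ∀ {R : Vector (Vector ℕ J) I} {S : Vector (Vector ℕ J) K} →
           (∀ r i s j → R r i ≢ S s j) →
           IsDGR I J n R → IsDGR K J n S → IsDGR (I + K) J n (R ++ S)
isDGR-++ {J = J} {I} {K} {n} {R} {S} R≢S D E = record
  { golomb = golomb ; range = range ; disjoint = disjoint }
  where
  module D = IsDGR D
  module E = IsDGR E

  golomb : ∀ r → IsGolombRuler ((R ++ S) r)
  golomb r with splitAt I r
  ... | inj₁ r′ = D.golomb r′
  ... | inj₂ r′ = E.golomb r′

  range : ∀ r i → 1 ≤ (R ++ S) r i × (R ++ S) r i ≤ n
  range r with splitAt I r
  ... | inj₁ r′ = D.range r′
  ... | inj₂ r′ = E.range r′

  disjoint : ∀ r s → r ≢ s → ∀ i j → (R ++ S) r i ≢ (R ++ S) s j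
  -- The saved equations recover `r` and `s` from their preimages, so equal preimages in the same
  -- half would force `r ≡ s`.
  disjoint r s r≢s i j with splitAt I r in eqr | splitAt I s in eqs
  ... | inj₁ r′ | inj₁ s′ = D.disjoint r′ s′ (λ r′≡s′ → r≢s
    (trans (sym (splitAt⁻¹-↑ˡ eqr)) (trans (cong (_↑ˡ K) r′≡s′) (splitAt⁻¹-↑ˡ eqs)))) i j
  ... | inj₁ r′ | inj₂ s′ = R≢S r′ i s′ j
  ... | inj₂ r′ | inj₁ s′ = ≢-sym (R≢S s′ j r′ i)
  ... | inj₂ r′ | inj₂ s′ = E.disjoint r′ s′ (λ r′≡s′ → r≢s
    (trans (sym (splitAt⁻¹-↑ʳ eqr)) (trans (cong (I ↑ʳ_) r′≡s′) (splitAt⁻¹-↑ʳ eqs)))) i j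

isDGR-∷ : ∀ {p : Vector ℕ I} {R : Vector (Vector ℕ J) I} → Injective _≡_ _≡_ p →
          (∀ r → 1 ≤ p r × p r ≤ n) → (∀ r s i → p r ≢ R s i) →
          (∀ r → IsRemote (p r) (R r)) →
          IsDGR I J n R → IsDGR I (suc J) n (λ r → p r ∷ R r)
isDGR-∷ {p = p} {R} p-inj p-range p≢R remote D = record
  { golomb   = λ r → isGolombRuler-∷ (remote r) (golomb r)
  ; range    = λ { r zero → p-range r ; r (suc i) → range r i }
  ; disjoint = disj
  }
  where
  open IsDGR D

  disj : ∀ r s → r ≢ s → ∀ i j → (p r ∷ R r) i ≢ (p s ∷ R s) j
  disj r s r≢s zero    zero    = r≢s ∘ p-inj
  disj r s r≢s zero    (suc j) = p≢R r s j
  disj r s r≢s (suc i) zero    = ≢-sym (p≢R s r i)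
  disj r s r≢s (suc i) (suc j) = disjoint r s r≢s i j

-- Extending rulers by remote points, and the two constructions

-- The new points fill 1 to `I`; the old rulers start after `I + c`, so `c` is the length of the gap
-- between them.
extendˡ : ℕ → Vector (Vector ℕ J) I → Vector (Vector ℕ (suc J)) I
extendˡ {I = I} c R r = suc (toℕ r) ∷ (λ i → (I + c) + R r i)

-- The old rulers stay in place, so here `c` is the position after which the new points start, not a
-- gap length.
extendʳ : ℕ → Vector (Vector ℕ J) I → Vector (Vector ℕ (suc J)) I
extendʳ c R r = (c + suc (toℕ r)) ∷ R r

isDGR-extendˡ : ∀ {c} {R : Vector (Vector ℕ J) I} → n ≤ c → I + c + n ≤ N →
                IsDGR I J n R → IsDGR I (suc J) N (extendˡ c R)
isDGR-extendˡ {I = I} {n = n} {c = c} {R} n≤c I+c+n≤N D = isDGR-∷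
  (toℕ-injective ∘ +-cancelˡ-≡ 1 _ _)
  (λ r → s≤s z≤n , ≤-trans (m≤n⇒m≤n+o n (m≤n⇒m≤n+o c (toℕ<n r))) I+c+n≤N)
  (λ r s i → <⇒≢ (new<old r s i))
  (λ r → record
    { double≢ = λ i j → <⇒≢ (+-mono-< (new<old r r i) (new<old r r j))
    ; sum≢    = λ i j k → <⇒≢ (begin-strict
        -- As `n ≤ c`, a shifted point is at most `I + c + c`; adding a new point gives at most
        -- twice `I + c`, which any two shifted points together exceed.
        suc (toℕ r) + (I + c + R r i)      ≤⟨ +-mono-≤ (toℕ<n r)
                                               (+-monoʳ-≤ (I + c) (≤-trans (proj₂ (range r i)) n≤c)) ⟩
        I + (I + c + c)                    ≡⟨ regroup I c ⟩
        (I + c) + (I + c)                  <⟨ +-mono-< (gap r j) (gap r k) ⟩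
        (I + c + R r j) + (I + c + R r k)  ∎)
    })
  (isDGR-translate (I + c) I+c+n≤N D)
  where
  open IsDGR D
  open ≤-Reasoning

  gap : ∀ r i → I + c < I + c + R r i
  gap r i = m<m+n (I + c) (proj₁ (range r i))

  new<old : ∀ (r s : Fin I) i → suc (toℕ r) < I + c + R s i
  new<old r s i = ≤-<-trans (m≤n⇒m≤n+o c (toℕ<n r)) (gap s i)

  regroup : ∀ x y → x + (x + y + y) ≡ (x + y) + (x + y)
  regroup = solve-∀

isDGR-extendʳ : ∀ {c} {R : Vector (Vector ℕ J) I} → n + n ≤ c → c + I ≤ N →
                IsDGR I J n R → IsDGR I (suc J) N (extendʳ c R)
isDGR-extendʳ {I = I} {n = n} {c = c} {R} n+n≤c c+I≤N D = isDGR-∷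
  (toℕ-injective ∘ +-cancelˡ-≡ 1 _ _ ∘ +-cancelˡ-≡ c _ _)
  (λ r → m≤n⇒m≤o+n c (s≤s z≤n) , ≤-trans (+-monoʳ-≤ c (toℕ<n r)) c+I≤N)
  (λ r s i → >⇒≢ (old<new r s i))
  (λ r → record
    { double≢ = λ i j → >⇒≢ (+-mono-< (old<new r r i) (old<new r r j))
    ; sum≢    = λ i j k → >⇒≢ (begin-strict
        R r j + R r k            ≤⟨ +-mono-≤ (proj₂ (range r j)) (proj₂ (range r k)) ⟩
        n + n                    ≤⟨ n+n≤c ⟩
        c                        <⟨ m<m+n c (s≤s z≤n) ⟩
        c + suc (toℕ r)          ≤⟨ m≤m+n (c + suc (toℕ r)) (R r i) ⟩
        c + suc (toℕ r) + R r i  ∎)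
    })
  -- Translation by 0 only enlarges the upper bound from `n` to `N`.
  (isDGR-translate 0 (≤-trans n≤c (m+n≤o⇒m≤o c c+I≤N)) D)
  where
  open IsDGR D
  open ≤-Reasoning

  n≤c : n ≤ c
  n≤c = m+n≤o⇒m≤o n n+n≤c

  old<new : ∀ (r s : Fin I) i → R s i < c + suc (toℕ r)
  old<new r s i = ≤-<-trans (≤-trans (proj₂ (range s i)) n≤c) (m<m+n c (s≤s z≤n))

hasDGR-mono : I′ ≤ I → J′ ≤ J → HasDGR I J n → HasDGR I′ J′ n
hasDGR-mono I′≤I J′≤J (R , D) = _ ,
  isDGR-reindex (inject≤-injective I′≤I I′≤I _ _) (inject≤-injective J′≤J J′≤J _ _) D

-- The `K` new points come first, `R` occupies `K + 1` to `K + n`, and `S` the next `m` places: the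
-- block of `R` is exactly the gap left by `extendˡ n S`.
hasDGR-+ : m ≤ n → HasDGR I (suc J) n → HasDGR K J m → HasDGR (I + K) (suc J) (n + m + K)
hasDGR-+ {m = m} {n} {I} {J} {K} m≤n (R , D) (S , E) =
  R⁺ ++ extendˡ n S , isDGR-++ separate (isDGR-translate K (m+n≤o⇒m≤o (K + n) fits) D)
                                        (isDGR-extendˡ m≤n fits E)
  where
  module D = IsDGR D
  module E = IsDGR E

  R⁺ : Vector (Vector ℕ (suc J)) I
  R⁺ r i = K + R r i

  total : ∀ x y z → x + y + z ≡ y + z + x
  total = solve-∀

  fits : K + n + m ≤ n + m + K
  fits = ≤-reflexive (total K n m)

  separate : ∀ r i s j → R⁺ r i ≢ extendˡ n S s j
  separate r i s zero    = >⇒≢ (≤-<-trans (toℕ<n s) (m<m+n K (proj₁ (D.range r i))))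
  separate r i s (suc j) = <⇒≢ (≤-<-trans (+-monoʳ-≤ K (proj₂ (D.range r i)))
                                 (m<m+n (K + n) (proj₁ (E.range s j))))

-- The copies occupy `I + 1` to `I + n` and the next `n` places. The upper one takes the new points
-- at the bottom, the lower one those at the top, so each copy fills the other's gap. For `extendʳ`
-- this means `c = n + n`: the copy itself plus a gap of `n`.
hasDGR-double : HasDGR I J n → HasDGR (I + I) (suc J) (2 * n + 2 * I)
hasDGR-double {I} {J} {n} (R , D) =
  extendˡ n R ++ R⁺ , isDGR-++ separate
    (isDGR-extendˡ ≤-refl (m+n≤o⇒m≤o (I + n + n) (≤-reflexive (totalˡ I n))) D)
    (isDGR-translate I (≤-reflexive (totalʳ I n)) (isDGR-extendʳ ≤-refl ≤-refl D))
  where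
  open IsDGR D

  R⁺ : Vector (Vector ℕ (suc J)) I
  R⁺ r i = I + extendʳ (n + n) R r i

  totalˡ : ∀ x y → x + y + y + x ≡ 2 * y + 2 * x
  totalˡ = solve-∀

  totalʳ : ∀ x y → x + (y + y + x) ≡ 2 * y + 2 * x
  totalʳ = solve-∀

  separate : ∀ r i s j → extendˡ n R r i ≢ R⁺ s j
  separate r zero    s zero    = <⇒≢ (≤-<-trans (toℕ<n r)
                                       (m<m+n I (m≤n⇒m≤o+n (n + n) (s≤s z≤n))))
  separate r zero    s (suc j) = <⇒≢ (≤-<-trans (toℕ<n r) (m<m+n I (proj₁ (range s j))))
  separate r (suc i) s zero    = <⇒≢ (begin-strict
    I + n + R r i              ≡⟨ +-assoc I n (R r i) ⟩
    I + (n + R r i)            ≤⟨ +-monoʳ-≤ I (+-monoʳ-≤ n (proj₂ (range r i))) ⟩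
    I + (n + n)                <⟨ +-monoʳ-< I (m<m+n (n + n) (s≤s z≤n)) ⟩
    I + (n + n + suc (toℕ s))  ∎)
    where open ≤-Reasoning
  separate r (suc i) s (suc j) = >⇒≢ (≤-<-trans (+-monoʳ-≤ I (proj₂ (range s j)))
                                       (m<m+n (I + n) (proj₁ (range r i))))

-- From constructions to bounds on `H`

hasDGR-H : ∀ I J → HasDGR I J (H I J)
hasDGR-H I J = proj₂ (proj₁ (H-isLeast I J))

H≥1 : ∀ I J → 1 ≤ H I J
H≥1 I J = proj₁ (proj₁ (H-isLeast I J))

H-minimal : 1 ≤ n → HasDGR I J n → H I J ≤ n
H-minimal {I = I} {J} 1≤n D = proj₂ (H-isLeast I J) (1≤n , D)

-- Dropping rulers and points preserves a DGR. This supplies `H b J′ ≤ H a J`, the gap condition of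
-- `hasDGR-+`.
H-mono-≤ : ∀ {I I′ J J′} → I′ ≤ I → J′ ≤ J → H I′ J′ ≤ H I J
H-mono-≤ {I} {I′} {J} {J′} I′≤I J′≤J =
  H-minimal {n = H I J} {I = I′} {J = J′} (H≥1 I J) (hasDGR-mono I′≤I J′≤J (hasDGR-H I J))

-- Indices are kept as variables constrained by equations: comparing H at two
-- merely convertible indices would make Agda unfold its search procedure.
H-+-≤ : ∀ a b I J J′ → I ≡ a + b → J ≡ suc J′ → b ≤ a → H I J ≤ H a J + H b J′ + b
H-+-≤ a b I J J′ refl refl b≤a = H-minimal {I = I} {J = J}
  (m≤n⇒m≤n+o b (m≤n⇒m≤n+o (H b J′) (H≥1 a J)))
  (hasDGR-+ (H-mono-≤ {a} {b} {J} {J′} b≤a (n≤1+n J′)) (hasDGR-H a J) (hasDGR-H b J′))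

H-double-≤ : ∀ a I J J′ → I ≡ a + a → J ≡ suc J′ → H I J ≤ 2 * H a J′ + 2 * a
H-double-≤ a I J J′ refl refl = H-minimal {I = I} {J = J}
  -- `2 * H a J′` unfolds to `H a J′ + (H a J′ + 0)`, whence the summand with 0.
  (m≤n⇒m≤n+o (2 * a) (m≤n⇒m≤n+o (H a J′ + 0) (H≥1 a J′)))
  (hasDGR-double (hasDGR-H a J′))

theorem4 : (a b J : ℕ) → a ≥ 1 → b ≥ 1 → J ≥ 3 →
    ((a ≥ b → H (a + b) J ≤ H a J + H b (J ∸ 1) + b) ×
    (a ≥ 2 → H (2 * a ∸ 1) J ≤ H a J + H (a ∸ 1) (J ∸ 1) + (a ∸ 1))) ×
    (H (2 * a) J ≤ 2 * H a (J ∸ 1) + 2 * a)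
theorem4 a b J a≥1 _ J≥3 =
  ( H-+-≤ a b (a + b) J (J ∸ 1) refl J≡1+[J∸1]
  -- The case `b = a ∸ 1`; `a ≥ 1` makes the truncated `2 * a ∸ 1` equal to `a + (a ∸ 1)`.
  , λ _ → H-+-≤ a (a ∸ 1) (2 * a ∸ 1) J (J ∸ 1) 2a∸1≡a+[a∸1] J≡1+[J∸1] (m∸n≤m a 1)) ,
  H-double-≤ a (2 * a) J (J ∸ 1) 2a≡a+a J≡1+[J∸1]
  where
  J≡1+[J∸1] : J ≡ suc (J ∸ 1)
  J≡1+[J∸1] = sym (m+[n∸m]≡n (≤-trans (s≤s z≤n) J≥3))

  2a≡a+a : 2 * a ≡ a + a
  2a≡a+a = cong (a +_) (+-identityʳ a)

  2a∸1≡a+[a∸1] : 2 * a ∸ 1 ≡ a + (a ∸ 1)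
  2a∸1≡a+[a∸1] = trans (cong (_∸ 1) 2a≡a+a) (+-∸-assoc a a≥1)
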